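{- Let $p$ be a prime number and let $\ell,m,s$ be non-negative integers such that $0<s<p$. Then $$\sum_{i\ge 0}(-1)^{m-i}\binom{m}{i}\binom{\ell+ip}{m+s-1}\equiv 0 \pmod{p^m},$$ and the quotient is an integer-valued polynomial function of $m$ of degree $s-1$; that is, for fixed $p,\ell,s$ there is a polynomial $Q\in\mathbb{Q}[x]$ of degree $s-1$, taking integer values at integers, such that for all integers $m\ge 0$ one has $$\sum_{i\ge 0}(-1)^{m-i}\binom{m}{i}\binom{\ell+ip}{m+s-1}=p^m Q(m).$$
   Context: $\binom{n}{k}$ is the usual binomial coefficient, equal to $0$ when $0\le n<k$; the sum is therefore finite. -}

module Defs where

import Algebra.Properties.CommutativeMonoid.Sum
open import Data.Fin.Base using (toℕ)
open import Data.Integer.Base as ℤ using (ℤ; +_; -1ℤ)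
import Data.Integer.Properties as ℤ
open import Data.List.Base using (List; []; _∷_)
open import Data.Nat.Base as ℕ using (ℕ; zero; suc; _+_; _*_; _∸_)
open import Data.Nat.Combinatorics using (_C_)
open import Data.Product.Base using (∃; _×_)
open import Data.Rational.Base as ℚ using (ℚ; 0ℚ)
open import Data.Rational.Literals using (fromℤ)
open import Relation.Binary.PropositionalEquality.Core using (_≡_; _≢_)

open Algebra.Properties.CommutativeMonoid.Sum ℤ.+-0-commutativeMonoid
  using (sum⁺-syntax)

-- The terms with i > m vanish because m C i = 0, so the sum over all i ≥ 0
-- is the sum over i = 0, …, m (bound included), where m ∸ i is the true
-- difference.  In m + s ∸ 1 the subtraction is also exact whenever 0 < s.
altSum : (p ℓ s m : ℕ) → ℤ
altSum p ℓ s m =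
  ∑[ i ≤ m ] (-1ℤ ℤ.^ (m ∸ toℕ i)
              ℤ.* + (m C toℕ i)
              ℤ.* + ((ℓ + toℕ i * p) C (m + s ∸ 1)))

-- Polynomials in ℚ[x] as coefficient lists, constant term first.  Trailing
-- zeros are allowed, so the length of the list does not determine the degree.
ℚ[x] : Set
ℚ[x] = List ℚ

coeff : ℚ[x] → ℕ → ℚ
coeff []      _       = 0ℚ
coeff (a ∷ _) zero    = a
coeff (_ ∷ Q) (suc k) = coeff Q k

eval : ℚ[x] → ℚ → ℚ
eval []      x = 0ℚ
eval (a ∷ Q) x = a ℚ.+ x ℚ.* eval Q x

HasDegree : ℚ[x] → ℕ → Set
HasDegree Q d = coeff Q d ≢ 0ℚ × (∀ k → d ℕ.< k → coeff Q k ≡ 0ℚ)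

IntegerValued : ℚ[x] → Set
IntegerValued Q = ∀ (z : ℤ) → ∃ λ (w : ℤ) → eval Q (fromℤ z) ≡ fromℤ w

{-# OPTIONS --safe #-}

-- On generating functions in y, the sum is the coefficient of y^(m+s-1) in
-- (1+y)^ℓ ((1+y)^p - 1)^m.  Dividing by y^m leaves the coefficient of y^(s-1) in
-- (1+y)^ℓ g(y)^m, where g(y) = Σ C(p,i+1) y^i.  Up to y^(p-2) the coefficients
-- of g are divisible by p, and s - 1 ≤ p - 2, so g may be replaced by
-- p (1 + y w(y)) with w integral.  Hence the quotient by p^m is
-- Σ_j C(m,j) [y^(s-1)] (1+y)^ℓ (y w(y))^j, a Newton expansion in m with integer
-- coefficients; only j ≤ s - 1 contributes, and the coefficient at j = s - 1 is
-- w(0)^(s-1), where w(0) = C(p,2)/p ≠ 0 as soon as s > 1.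
module Submission where

open import Defs
open import Data.Fin.Base using (toℕ)
open import Data.Integer.Base as ℤ
  using (ℤ; +_; -[1+_]; 0ℤ; 1ℤ; -1ℤ; _+_; _*_; _-_; -_; _^_)
open import Data.Integer.Divisibility using (_∣_)
import Data.Integer.Properties as ℤ
open import Data.Integer.Tactic.RingSolver using (solve-∀)
open import Data.List.Base using ([]; _∷_)
open import Data.Nat.Base as ℕ using (ℕ; zero; suc; _∸_; _<_; _≤_; z≤n; s≤s; z<s; s<s)
open import Data.Nat.Combinatorics using (_C_; nCk+nC[k+1]≡[n+1]C[k+1]; k>n⇒nCk≡0; nC1≡n)
import Data.Nat.DivMod as ℕ
import Data.Nat.Divisibility as ℕ
open import Data.Nat.Primality using (Prime; euclidsLemma; prime⇒nonZero)
import Data.Nat.Properties as ℕ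
import Data.Nat.Tactic.RingSolver as ℕ-Solver
open import Data.Product.Base using (∃; _×_; _,_; proj₂)
open import Data.Rational.Base as ℚ using (ℚ; 0ℚ; 1ℚ)
open import Data.Rational.Literals using (fromℤ)
import Data.Rational.Properties as ℚ
open import Data.Rational.Solver using (module +-*-Solver)
open import Data.Sum.Base using (inj₁; inj₂)
open import Function.Base using (_∘_)
open import Relation.Binary.PropositionalEquality
  using (_≡_; _≢_; _≗_; refl; sym; trans; cong; cong₂; subst; module ≡-Reasoning)
open import Relation.Nullary using (contradiction)

import Algebra.Properties.CommutativeMonoid.Sum
open Algebra.Properties.CommutativeMonoid.Sum ℤ.+-0-commutativeMonoid
  using (sum⁺-syntax; sum-cong-≗)

open ≡-Reasoning

-- Cauchy product of sequences

infixl 7 _⊛_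

_⊛_ : (ℕ → ℤ) → (ℕ → ℤ) → ℕ → ℤ
(a ⊛ b) zero    = a 0 * b 0
(a ⊛ b) (suc n) = a 0 * b (suc n) + ((a ∘ suc) ⊛ b) n

private variable
  a a′ b b′ f g : ℕ → ℤ

-- Agreement is asked only up to index `n`, because `binom p (suc i)` is a multiple of `p` only for
-- `suc i < p`.
⊛-cong : ∀ n → (∀ i → i ≤ n → a i ≡ a′ i) → (∀ i → i ≤ n → b i ≡ b′ i) →
         (a ⊛ b) n ≡ (a′ ⊛ b′) n
⊛-cong zero    a≡ b≡ = cong₂ _*_ (a≡ 0 z≤n) (b≡ 0 z≤n)
⊛-cong (suc n) a≡ b≡ = cong₂ _+_ (cong₂ _*_ (a≡ 0 z≤n) (b≡ (suc n) ℕ.≤-refl))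
  (⊛-cong n (λ i i≤n → a≡ (suc i) (s≤s i≤n)) (λ i i≤n → b≡ i (ℕ.m≤n⇒m≤1+n i≤n)))

⊛-congʳ : ∀ n → (∀ i → i ≤ n → b i ≡ b′ i) → (a ⊛ b) n ≡ (a ⊛ b′) n
⊛-congʳ n = ⊛-cong n (λ _ _ → refl)

⊛-sucʳ : ∀ a b n → (a ⊛ b) (suc n) ≡ (a ⊛ (b ∘ suc)) n + a (suc n) * b 0
⊛-sucʳ a b zero    = refl
⊛-sucʳ a b (suc n) = begin
  a 0 * b (2 ℕ.+ n) + ((a ∘ suc) ⊛ b) (suc n)
    ≡⟨ cong (λ x → a 0 * b (2 ℕ.+ n) + x) (⊛-sucʳ (a ∘ suc) b n) ⟩
  a 0 * b (2 ℕ.+ n) + (((a ∘ suc) ⊛ (b ∘ suc)) n + a (2 ℕ.+ n) * b 0)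
    ≡⟨ ℤ.+-assoc (a 0 * b (2 ℕ.+ n)) _ _ ⟨
  (a ⊛ (b ∘ suc)) (suc n) + a (2 ℕ.+ n) * b 0 ∎

⊛-comm : ∀ a b n → (a ⊛ b) n ≡ (b ⊛ a) n
⊛-comm a b zero    = ℤ.*-comm (a 0) (b 0)
⊛-comm a b (suc n) = begin
  a 0 * b (suc n) + ((a ∘ suc) ⊛ b) n  ≡⟨ cong₂ _+_ (ℤ.*-comm (a 0) _) (⊛-comm (a ∘ suc) b n) ⟩
  b (suc n) * a 0 + (b ⊛ (a ∘ suc)) n  ≡⟨ ℤ.+-comm (b (suc n) * a 0) _ ⟩
  (b ⊛ (a ∘ suc)) n + b (suc n) * a 0  ≡⟨ ⊛-sucʳ b a n ⟨
  (b ⊛ a) (suc n)                      ∎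

⊛-distribˡ-+ : ∀ a f g n → (a ⊛ (λ i → f i + g i)) n ≡ (a ⊛ f) n + (a ⊛ g) n
⊛-distribˡ-+ a f g zero    = ℤ.*-distribˡ-+ (a 0) (f 0) (g 0)
⊛-distribˡ-+ a f g (suc n)
  rewrite ⊛-distribˡ-+ (a ∘ suc) f g n = lemma (a 0) (f (suc n)) (g (suc n)) _ _
  where
  lemma : ∀ x y z u v → x * (y + z) + (u + v) ≡ (x * y + u) + (x * z + v)
  lemma = solve-∀

⊛-distribʳ-+ : ∀ a b f n → ((λ i → a i + b i) ⊛ f) n ≡ (a ⊛ f) n + (b ⊛ f) n
⊛-distribʳ-+ a b f n = begin
  ((λ i → a i + b i) ⊛ f) n  ≡⟨ ⊛-comm _ f n ⟩
  (f ⊛ (λ i → a i + b i)) n  ≡⟨ ⊛-distribˡ-+ f a b n ⟩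
  (f ⊛ a) n + (f ⊛ b) n      ≡⟨ cong₂ _+_ (⊛-comm f a n) (⊛-comm f b n) ⟩
  (a ⊛ f) n + (b ⊛ f) n      ∎

⊛-scaleʳ : ∀ c a f n → (a ⊛ (λ i → c * f i)) n ≡ c * (a ⊛ f) n
⊛-scaleʳ c a f zero    = lemma (a 0) c (f 0)
  where
  lemma : ∀ x y z → x * (y * z) ≡ y * (x * z)
  lemma = solve-∀
⊛-scaleʳ c a f (suc n)
  rewrite ⊛-scaleʳ c (a ∘ suc) f n = lemma (a 0) c (f (suc n)) _
  where
  lemma : ∀ x y z u → x * (y * z) + y * u ≡ y * (x * z + u)
  lemma = solve-∀

⊛-scaleˡ : ∀ c a f n → ((λ i → c * a i) ⊛ f) n ≡ c * (a ⊛ f) n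
⊛-scaleˡ c a f n = begin
  ((λ i → c * a i) ⊛ f) n  ≡⟨ ⊛-comm _ f n ⟩
  (f ⊛ (λ i → c * a i)) n  ≡⟨ ⊛-scaleʳ c f a n ⟩
  c * (f ⊛ a) n            ≡⟨ cong (c *_) (⊛-comm f a n) ⟩
  c * (a ⊛ f) n            ∎

⊛-distribˡ-minus : ∀ a f g n → (a ⊛ (λ i → f i - g i)) n ≡ (a ⊛ f) n - (a ⊛ g) n
⊛-distribˡ-minus a f g n = begin
  (a ⊛ (λ i → f i - g i)) n             ≡⟨ ⊛-distribˡ-+ a f (-_ ∘ g) n ⟩
  (a ⊛ f) n + (a ⊛ (-_ ∘ g)) n          ≡⟨ cong (λ x → (a ⊛ f) n + x) (⊛-congʳ n λ i _ → ℤ.-1*i≡-i (g i)) ⟨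
  (a ⊛ f) n + (a ⊛ (λ i → -1ℤ * g i)) n ≡⟨ cong (λ x → (a ⊛ f) n + x) (⊛-scaleʳ -1ℤ a g n) ⟩
  (a ⊛ f) n + -1ℤ * (a ⊛ g) n           ≡⟨ cong (λ x → (a ⊛ f) n + x) (ℤ.-1*i≡-i ((a ⊛ g) n)) ⟩
  (a ⊛ f) n - (a ⊛ g) n                 ∎

⊛-zeroʳ : ∀ n → (∀ i → i ≤ n → f i ≡ 0ℤ) → (a ⊛ f) n ≡ 0ℤ
⊛-zeroʳ {f} {a} n f≡0 = begin
  (a ⊛ f) n              ≡⟨ ⊛-congʳ n f≡0 ⟩
  -- The zero sequence is displayed as a multiple by 0, so that scaling gives the result.
  (a ⊛ (λ _ → 0ℤ * 0ℤ)) n ≡⟨ ⊛-scaleʳ 0ℤ a (λ _ → 0ℤ) n ⟩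
  0ℤ                     ∎

-- A factor y^m of the right-hand series can be pulled out of the product; each induction step drops
-- one vanishing head of `f`.
⊛-shiftʳ : ∀ m t → (∀ i → i < m → f i ≡ 0ℤ) →
           (a ⊛ f) (m ℕ.+ t) ≡ (a ⊛ (λ j → f (m ℕ.+ j))) t
⊛-shiftʳ zero t f≡0 = refl
⊛-shiftʳ {f} {a} (suc m) t f≡0 = begin
  (a ⊛ f) (suc m ℕ.+ t)
    ≡⟨ ⊛-sucʳ a f (m ℕ.+ t) ⟩
  (a ⊛ (f ∘ suc)) (m ℕ.+ t) + a (suc m ℕ.+ t) * f 0
    ≡⟨ cong₂ _+_ (⊛-shiftʳ m t λ i i<m → f≡0 (suc i) (s<s i<m)) (cong (a _ *_) (f≡0 0 z<s)) ⟩
  (a ⊛ (λ j → f (suc m ℕ.+ j))) t + a (suc m ℕ.+ t) * 0ℤ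
    ≡⟨ cong (λ x → (a ⊛ (λ j → f (suc m ℕ.+ j))) t + x) (ℤ.*-zeroʳ (a (suc m ℕ.+ t))) ⟩
  (a ⊛ (λ j → f (suc m ℕ.+ j))) t + 0ℤ
    ≡⟨ ℤ.+-identityʳ _ ⟩
  (a ⊛ (λ j → f (suc m ℕ.+ j))) t ∎

∑≡⊛ : ∀ a b m → ∑[ i ≤ m ] (a (toℕ i) * b (m ∸ toℕ i)) ≡ (a ⊛ b) m
∑≡⊛ a b zero    = ℤ.+-identityʳ _
∑≡⊛ a b (suc m) = cong (λ x → a 0 * b (suc m) + x) (∑≡⊛ (a ∘ suc) b m)

-- Multiplication by y a(y) on generating functions.
step : (ℕ → ℤ) → (ℕ → ℤ) → ℕ → ℤ
step a f zero    = 0ℤ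
step a f (suc n) = (a ⊛ f) n

step-congʳ : f ≗ g → step a f ≗ step a g
step-congʳ f≗g zero    = refl
step-congʳ f≗g (suc n) = ⊛-congʳ n (λ i _ → f≗g i)

step-+ : ∀ a f g n → step a (λ i → f i + g i) n ≡ step a f n + step a g n
step-+ a f g zero    = refl
step-+ a f g (suc n) = ⊛-distribˡ-+ a f g n

-- The factor y in `step` raises the order of vanishing by one.
step-vanish : ∀ {m} → (∀ i → i < m → f i ≡ 0ℤ) → ∀ i → i < suc m → step a f i ≡ 0ℤ
step-vanish f≡0 zero    i<m       = refl
step-vanish f≡0 (suc i) (s<s i<m) = ⊛-zeroʳ i (λ j j≤i → f≡0 j (ℕ.≤-<-trans j≤i i<m))

-- Binomial coefficients

binom : ℕ → ℕ → ℤ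
binom n k = + (n C k)

pascal : ∀ n k → binom (suc n) (suc k) ≡ binom n k + binom n (suc k)
pascal n k = cong +_ (sym (nCk+nC[k+1]≡[n+1]C[k+1] n k))

-- Coefficients of (1+y)^(q+n) = (1+y)^q (1+y)^n, by induction on `q` through Pascal's rule.
vandermonde : ∀ q n k → binom (q ℕ.+ n) k ≡ (binom q ⊛ binom n) k
vandermonde zero n zero = refl
vandermonde zero n (suc k) = begin
  binom n (suc k)                                         ≡⟨ lemma _ ⟩
  -- The tail of `binom 0` is zero; writing it as `0ℤ * binom 0 i` makes the tail product a multiple
  -- by 0.
  1ℤ * binom n (suc k) + 0ℤ * (binom 0 ⊛ binom n) k       ≡⟨ cong (λ x → 1ℤ * binom n (suc k) + x) (⊛-scaleˡ 0ℤ (binom 0) (binom n) k) ⟨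
  1ℤ * binom n (suc k) + ((λ i → 0ℤ * binom 0 i) ⊛ binom n) k ≡⟨⟩
  (binom 0 ⊛ binom n) (suc k)                              ∎
  where
  lemma : ∀ x → x ≡ 1ℤ * x + 0ℤ
  lemma = solve-∀
vandermonde (suc q) n zero    = refl
vandermonde (suc q) n (suc k) = begin
  binom (suc q ℕ.+ n) (suc k)
    ≡⟨ pascal (q ℕ.+ n) k ⟩
  binom (q ℕ.+ n) k + binom (q ℕ.+ n) (suc k)
    ≡⟨ cong₂ _+_ (vandermonde q n k) (vandermonde q n (suc k)) ⟩
  (binom q ⊛ binom n) k + (binom q 0 * binom n (suc k) + ((binom q ∘ suc) ⊛ binom n) k)
    ≡⟨ reorder ((binom q ⊛ binom n) k) (binom n (suc k)) _ ⟩
  1ℤ * binom n (suc k) + ((binom q ⊛ binom n) k + ((binom q ∘ suc) ⊛ binom n) k)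
    ≡⟨ cong (λ x → 1ℤ * binom n (suc k) + x) (⊛-distribʳ-+ (binom q) (binom q ∘ suc) (binom n) k) ⟨
  1ℤ * binom n (suc k) + ((λ i → binom q i + binom q (suc i)) ⊛ binom n) k
    ≡⟨ cong (λ x → 1ℤ * binom n (suc k) + x) (⊛-cong k (λ i _ → sym (pascal q i)) (λ _ _ → refl)) ⟩
  (binom (suc q) ⊛ binom n) (suc k) ∎
  where
  reorder : ∀ x y z → x + (1ℤ * y + z) ≡ 1ℤ * y + (x + z)
  reorder = solve-∀

-- Finite differences

-- With E the shift, this is (E - 1)^m f at 0.
diff : ℕ → (ℕ → ℤ) → ℤ
diff zero    f = f 0
diff (suc m) f = diff m (f ∘ suc) - diff m f

diff-cong : ∀ m → f ≗ g → diff m f ≡ diff m g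
diff-cong zero    f≗g = f≗g 0
diff-cong (suc m) f≗g = cong₂ _-_ (diff-cong m (f≗g ∘ suc)) (diff-cong m f≗g)

-- The product is linear in its right factor, so differences in the parameter `i` pass through it.
diff-⊛ : ∀ m a (F : ℕ → ℕ → ℤ) k →
         diff m (λ i → (a ⊛ F i) k) ≡ (a ⊛ (λ j → diff m (λ i → F i j))) k
diff-⊛ zero    a F k = refl
diff-⊛ (suc m) a F k = begin
  diff m (λ i → (a ⊛ F (suc i)) k) - diff m (λ i → (a ⊛ F i) k)
    ≡⟨ cong₂ _-_ (diff-⊛ m a (F ∘ suc) k) (diff-⊛ m a F k) ⟩
  (a ⊛ (λ j → diff m (λ i → F (suc i) j))) k - (a ⊛ (λ j → diff m (λ i → F i j))) k
    ≡⟨ ⊛-distribˡ-minus a _ _ k ⟨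
  (a ⊛ (λ j → diff (suc m) (λ i → F i j))) k ∎

-1^ : ℕ → ℤ
-1^ n = -1ℤ ^ n

-- The sequence `-1^` has generating function 1/(1+y), and (1+y) · a/(1+y) = a.
⊛-alternating : ∀ a n → (a ⊛ -1^) (suc n) ≡ a (suc n) - (a ⊛ -1^) n
⊛-alternating a n = begin
  (a ⊛ -1^) (suc n)                             ≡⟨ ⊛-sucʳ a -1^ n ⟩
  (a ⊛ (λ i → -1ℤ * -1^ i)) n + a (suc n) * 1ℤ  ≡⟨ cong (_+ a (suc n) * 1ℤ) (⊛-scaleʳ -1ℤ a -1^ n) ⟩
  -1ℤ * (a ⊛ -1^) n + a (suc n) * 1ℤ            ≡⟨ lemma ((a ⊛ -1^) n) (a (suc n)) ⟩
  a (suc n) - (a ⊛ -1^) n                       ∎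
  where
  lemma : ∀ x y → -1ℤ * x + y * 1ℤ ≡ y - x
  lemma = solve-∀

-- Pascal's rule splits the alternating sum for `suc m` into one for `f ∘ suc` and one for `f`;
-- reading the latter one index higher reverses its sign by `⊛-alternating`.
binom⊛-1^≡diff : ∀ m f → ((λ i → binom m i * f i) ⊛ -1^) m ≡ diff m f
binom⊛-1^≡diff zero    f = lemma (f 0)
  where
  lemma : ∀ x → 1ℤ * x * 1ℤ ≡ x
  lemma = solve-∀
binom⊛-1^≡diff (suc m) f = begin
  c * f 0 * -1^ (suc m) + ((λ i → binom (suc m) (suc i) * f (suc i)) ⊛ -1^) m
    ≡⟨ cong (λ x → c * f 0 * -1^ (suc m) + x) (trans
         (⊛-cong m (λ i _ → trans (cong (_* f (suc i)) (pascal m i))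
                             (ℤ.*-distribʳ-+ (f (suc i)) (binom m i) (binom m (suc i))))
                   (λ _ _ → refl))
         (⊛-distribʳ-+ _ _ -1^ m)) ⟩
  c * f 0 * -1^ (suc m) + (((λ i → binom m i * f (suc i)) ⊛ -1^) m + ((u ∘ suc) ⊛ -1^) m)
    -- Both `binom (suc m) 0` and `binom m 0` reduce to 1, so the leading term is the missing head
    -- of `u ⊛ -1^` at `suc m`.
    ≡⟨ lemma (c * f 0 * -1^ (suc m)) (((λ i → binom m i * f (suc i)) ⊛ -1^) m) _ ⟩
  ((λ i → binom m i * f (suc i)) ⊛ -1^) m + (u ⊛ -1^) (suc m)
    ≡⟨ cong₂ _+_ (binom⊛-1^≡diff m (f ∘ suc)) (⊛-alternating u m) ⟩
  diff m (f ∘ suc) + (binom m (suc m) * f (suc m) - (u ⊛ -1^) m)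
    ≡⟨ cong (λ x → diff m (f ∘ suc) + (x * f (suc m) - (u ⊛ -1^) m)) (cong +_ (k>n⇒nCk≡0 (ℕ.n<1+n m))) ⟩
  diff m (f ∘ suc) + (0ℤ * f (suc m) - (u ⊛ -1^) m)
    ≡⟨ cong (λ x → diff m (f ∘ suc) + x) (ℤ.+-identityˡ _) ⟩
  diff m (f ∘ suc) - (u ⊛ -1^) m
    ≡⟨ cong (λ x → diff m (f ∘ suc) - x) (binom⊛-1^≡diff m f) ⟩
  diff (suc m) f ∎
  where
  c = binom (suc m) 0
  u : ℕ → ℤ
  u i = binom m i * f i
  lemma : ∀ x y z → x + (y + z) ≡ y + (x + z)
  lemma = solve-∀

altSum≡diff : ∀ p ℓ s m → altSum p ℓ s m ≡ diff m (λ i → binom (ℓ ℕ.+ i ℕ.* p) (m ℕ.+ s ∸ 1))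
altSum≡diff p ℓ s m = begin
  altSum p ℓ s m
    ≡⟨ sum-cong-≗ {suc m} (λ i → lemma (-1^ (m ∸ toℕ i)) (binom m (toℕ i)) (v (toℕ i))) ⟩
  ∑[ i ≤ m ] (binom m (toℕ i) * v (toℕ i) * -1^ (m ∸ toℕ i))
    ≡⟨ ∑≡⊛ (λ i → binom m i * v i) -1^ m ⟩
  ((λ i → binom m i * v i) ⊛ -1^) m
    ≡⟨ binom⊛-1^≡diff m v ⟩
  diff m v ∎
  where
  v : ℕ → ℤ
  v i = binom (ℓ ℕ.+ i ℕ.* p) (m ℕ.+ s ∸ 1)
  lemma : ∀ x y z → x * y * z ≡ y * z * x
  lemma = solve-∀

-- Differences of binomial coefficients along ℓ + ip

module _ (p ℓ : ℕ) where

  -- For fixed `m`, the coefficient sequence of (1+y)^ℓ ((1+y)^p - 1)^m.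
  progDiff : ℕ → ℕ → ℤ
  progDiff m k = diff m (λ i → binom (ℓ ℕ.+ i ℕ.* p) k)

  -- Moving from i to i+1 multiplies by (1+y)^p, so one more difference multiplies by (1+y)^p - 1 =
  -- y g(y).
  progDiff-suc : ∀ m → progDiff (suc m) ≗ step (binom p ∘ suc) (progDiff m)
  progDiff-suc m k = trans (cong (_- progDiff m k) eq) (cancel k)
    where
    reorder : ∀ i → ℓ ℕ.+ suc i ℕ.* p ≡ p ℕ.+ (ℓ ℕ.+ i ℕ.* p)
    reorder i = begin
      ℓ ℕ.+ (p ℕ.+ i ℕ.* p) ≡⟨ ℕ.+-assoc ℓ p _ ⟨
      ℓ ℕ.+ p ℕ.+ i ℕ.* p   ≡⟨ cong (ℕ._+ i ℕ.* p) (ℕ.+-comm ℓ p) ⟩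
      p ℕ.+ ℓ ℕ.+ i ℕ.* p   ≡⟨ ℕ.+-assoc p ℓ _ ⟩
      p ℕ.+ (ℓ ℕ.+ i ℕ.* p) ∎
    eq : diff m (λ i → binom (ℓ ℕ.+ suc i ℕ.* p) k) ≡ (binom p ⊛ progDiff m) k
    eq = trans
      (diff-cong m (λ i → trans (cong (λ n → binom n k) (reorder i)) (vandermonde p (ℓ ℕ.+ i ℕ.* p) k)))
      (diff-⊛ m (binom p) (λ i → binom (ℓ ℕ.+ i ℕ.* p)) k)
    lemma₁ : ∀ x → 1ℤ * x - x ≡ 0ℤ
    lemma₁ = solve-∀
    lemma₂ : ∀ x y → 1ℤ * x + y - x ≡ y
    lemma₂ = solve-∀
    -- The constant term 1 of (1+y)^p reproduces the subtracted copy.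
    cancel : ∀ k → (binom p ⊛ progDiff m) k - progDiff m k ≡ step (binom p ∘ suc) (progDiff m) k
    cancel zero    = lemma₁ (progDiff m 0)
    cancel (suc k) = lemma₂ (progDiff m (suc k)) _

  progDiff-vanish : ∀ m k → k < m → progDiff m k ≡ 0ℤ
  progDiff-vanish (suc m) k k<1+m =
    trans (progDiff-suc m k) (step-vanish (progDiff-vanish m) k k<1+m)

  -- Once y^m is divided out, each further difference is plain multiplication by g(y).
  progDiff-shift : ∀ m t → progDiff (suc m) (suc m ℕ.+ t) ≡
                   ((binom p ∘ suc) ⊛ (λ j → progDiff m (m ℕ.+ j))) t
  progDiff-shift m t = trans (progDiff-suc m (suc m ℕ.+ t))
    (⊛-shiftʳ m t (progDiff-vanish m))

-- grow and stepPow are multiplication by (1 + y w(y))ᵐ and (y w(y))ʲ on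
-- generating functions.
module _ (w : ℕ → ℤ) where

  grow : (ℕ → ℤ) → ℕ → ℕ → ℤ
  grow g zero    n = g n
  grow g (suc m) n = grow g m n + step w (grow g m) n

  stepPow : (ℕ → ℤ) → ℕ → ℕ → ℤ
  stepPow g zero    = g
  stepPow g (suc j) = stepPow (step w g) j

  -- Multiplications by series commute. This reconciles `grow`, which applies `step` last, with
  -- `stepPow`, which applies it to the initial sequence.
  step-grow : ∀ g m → step w (grow g m) ≗ grow (step w g) m
  step-grow g zero    n = refl
  step-grow g (suc m) n = trans
    (step-+ w (grow g m) (step w (grow g m)) n)
    (cong₂ _+_ (step-grow g m n) (step-congʳ (step-grow g m) n))

  -- The order `m` is kept general because the induction replaces `g` by `step w g`, of order
  -- `suc m`.
  stepPow-vanish : ∀ {m} j → (∀ i → i < m → g i ≡ 0ℤ) →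
                   ∀ i → i < j ℕ.+ m → stepPow g j i ≡ 0ℤ
  stepPow-vanish         zero    g≡0         = g≡0
  stepPow-vanish {m = m} (suc j) g≡0 i i<j+m =
    stepPow-vanish j (step-vanish g≡0) i (subst (i <_) (sym (ℕ.+-suc j m)) i<j+m)

  -- The lowest coefficient of a product of series is the product of the lowest coefficients.
  stepPow-lead : ∀ {m} j → (∀ i → i < m → g i ≡ 0ℤ) →
                 stepPow g j (j ℕ.+ m) ≡ w 0 ^ j * g m
  stepPow-lead {g} {m} zero    g≡0 = sym (ℤ.*-identityˡ (g m))
  stepPow-lead {g} {m} (suc j) g≡0 = begin
    stepPow (step w g) j (suc j ℕ.+ m)  ≡⟨ cong (stepPow (step w g) j) (ℕ.+-suc j m) ⟨
    stepPow (step w g) j (j ℕ.+ suc m)  ≡⟨ stepPow-lead j (step-vanish g≡0) ⟩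
    -- Written as `m + 0`, the index lets `⊛-shiftʳ` remove y^m and leave a single product.
    w 0 ^ j * (w ⊛ g) m                 ≡⟨ cong (λ k → w 0 ^ j * (w ⊛ g) k) (ℕ.+-identityʳ m) ⟨
    w 0 ^ j * (w ⊛ g) (m ℕ.+ 0)         ≡⟨ cong (w 0 ^ j *_) (⊛-shiftʳ m 0 g≡0) ⟩
    w 0 ^ j * (w 0 * g (m ℕ.+ 0))       ≡⟨ cong (λ k → w 0 ^ j * (w 0 * g k)) (ℕ.+-identityʳ m) ⟩
    w 0 ^ j * (w 0 * g m)               ≡⟨ lemma (w 0 ^ j) (w 0) (g m) ⟩
    w 0 * w 0 ^ j * g m                 ∎
    where
    lemma : ∀ x y z → x * (y * z) ≡ y * x * z
    lemma = solve-∀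

-- Divisibility of binomial coefficients by a prime

[1+k]*[1+n]C[1+k]≡[1+n]*nCk : ∀ n k → suc k ℕ.* (suc n C suc k) ≡ suc n ℕ.* (n C k)
[1+k]*[1+n]C[1+k]≡[1+n]*nCk n zero = begin
  1 ℕ.* (suc n C 1)  ≡⟨ ℕ.*-identityˡ _ ⟩
  suc n C 1          ≡⟨ nC1≡n (suc n) ⟩
  suc n              ≡⟨ ℕ.*-identityʳ (suc n) ⟨
  suc n ℕ.* 1        ∎
[1+k]*[1+n]C[1+k]≡[1+n]*nCk zero (suc k) = ℕ.*-zeroʳ (suc (suc k))
[1+k]*[1+n]C[1+k]≡[1+n]*nCk (suc n) (suc k) = begin
  suc (suc k) ℕ.* (suc (suc n) C suc (suc k))
    ≡⟨ cong (suc (suc k) ℕ.*_) (nCk+nC[k+1]≡[n+1]C[k+1] (suc n) (suc k)) ⟨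
  suc (suc k) ℕ.* (u ℕ.+ v)
    -- One copy of `u` is set aside: the induction hypotheses turn the rest into `suc n` copies of
    -- `u`, and the spare one makes `suc (suc n)`.
    ≡⟨ lemma₁ (suc k) u v ⟩
  suc k ℕ.* u ℕ.+ (u ℕ.+ suc (suc k) ℕ.* v)
    ≡⟨ cong₂ (λ x y → x ℕ.+ (u ℕ.+ y)) ([1+k]*[1+n]C[1+k]≡[1+n]*nCk n k) ([1+k]*[1+n]C[1+k]≡[1+n]*nCk n (suc k)) ⟩
  suc n ℕ.* (n C k) ℕ.+ (u ℕ.+ suc n ℕ.* (n C suc k))
    ≡⟨ lemma₂ (suc n) (n C k) u (n C suc k) ⟩
  u ℕ.+ suc n ℕ.* (n C k ℕ.+ n C suc k)
    ≡⟨ cong (λ x → u ℕ.+ suc n ℕ.* x) (nCk+nC[k+1]≡[n+1]C[k+1] n k) ⟩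
  suc (suc n) ℕ.* (suc n C suc k) ∎
  where
  u = suc n C suc k
  v = suc n C suc (suc k)
  lemma₁ : ∀ k u v → suc k ℕ.* (u ℕ.+ v) ≡ k ℕ.* u ℕ.+ (u ℕ.+ suc k ℕ.* v)
  lemma₁ = ℕ-Solver.solve-∀
  lemma₂ : ∀ n a u b → n ℕ.* a ℕ.+ (u ℕ.+ n ℕ.* b) ≡ u ℕ.+ n ℕ.* (a ℕ.+ b)
  lemma₂ = ℕ-Solver.solve-∀

k≤n⇒nCk≢0 : ∀ {n k} → k ≤ n → n C k ≢ 0
k≤n⇒nCk≢0 z≤n                 ()
k≤n⇒nCk≢0 {suc n} {suc k} (s≤s k≤n) eq =
  k≤n⇒nCk≢0 k≤n (ℕ.m+n≡0⇒m≡0 _ (trans (nCk+nC[k+1]≡[n+1]C[k+1] n k) eq))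

-- By absorption `p` divides (k+1) C(p,k+1), and it cannot divide k+1, which lies strictly between 0
-- and `p`.
prime∣pC[1+k] : ∀ {p k} → Prime p → suc k < p → p ℕ.∣ p C suc k
prime∣pC[1+k] {suc n} {k} pr 1+k<p
  with euclidsLemma (suc k) (suc n C suc k) pr
         (subst (suc n ℕ.∣_) (sym ([1+k]*[1+n]C[1+k]≡[1+n]*nCk n k)) (ℕ.m∣m*n (n C k)))
... | inj₁ p∣1+k = contradiction p∣1+k (ℕ.>⇒∤ 1+k<p)
... | inj₂ p∣C   = p∣C

-- Extracting the power of p

module _ {p : ℕ} (pr : Prime p) where

  private instance
    p≢0 : ℕ.NonZero p
    p≢0 = prime⇒nonZero pr

  -- The coefficients of g(y)/p = 1 + y w(y); the division is exact for `suc i < p`, that is, up to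
  -- y^(p-2).
  binomQuot : ℕ → ℤ
  binomQuot i = + ((p C suc i) ℕ./ p)

  binom-p≡p*binomQuot : ∀ i → suc i < p → binom p (suc i) ≡ + p * binomQuot i
  binom-p≡p*binomQuot i 1+i<p = begin
    + (p C suc i)                     ≡⟨ cong +_ (ℕ.m*[n/m]≡n (prime∣pC[1+k] pr 1+i<p)) ⟨
    + (p ℕ.* ((p C suc i) ℕ./ p))     ≡⟨ ℤ.pos-* p _ ⟩
    + p * binomQuot i                 ∎

  binomQuot-0 : binomQuot 0 ≡ 1ℤ
  binomQuot-0 = cong +_ (trans (cong (ℕ._/ p) (nC1≡n p)) (ℕ.n/n≡1 p))

  binomQuot≢0 : ∀ {i} → suc i < p → binomQuot i ≢ 0ℤ
  binomQuot≢0 {i} 1+i<p eq = k≤n⇒nCk≢0 (ℕ.<⇒≤ 1+i<p) (ℤ.+-injective (begin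
    + (p C suc i)      ≡⟨ binom-p≡p*binomQuot i 1+i<p ⟩
    + p * binomQuot i  ≡⟨ cong (+ p *_) eq ⟩
    + p * 0ℤ           ≡⟨ ℤ.*-zeroʳ (+ p) ⟩
    0ℤ                 ∎))

  -- Each difference contributes a factor g, equal to p (1 + y w(y)) up to y^t. Coefficient `t` of
  -- the product involves only indices up to `t`, so the induction on `m` runs over all admissible
  -- `t` at once.
  progDiff-factor : ∀ ℓ m t → suc t < p →
    progDiff p ℓ m (m ℕ.+ t) ≡ (+ p) ^ m * grow (binomQuot ∘ suc) (binom ℓ) m t
  progDiff-factor ℓ zero    t 1+t<p = begin
    binom (ℓ ℕ.+ 0) t  ≡⟨ cong (λ n → binom n t) (ℕ.+-identityʳ ℓ) ⟩
    binom ℓ t          ≡⟨ ℤ.*-identityˡ (binom ℓ t) ⟨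
    1ℤ * binom ℓ t     ∎
  progDiff-factor ℓ (suc m) t 1+t<p = begin
    progDiff p ℓ (suc m) (suc m ℕ.+ t)
      ≡⟨ progDiff-shift p ℓ m t ⟩
    ((binom p ∘ suc) ⊛ (λ j → progDiff p ℓ m (m ℕ.+ j))) t
      ≡⟨ ⊛-cong t (λ i i≤t → binom-p≡p*binomQuot i (below i≤t))
                  (λ j j≤t → progDiff-factor ℓ m j (below j≤t)) ⟩
    ((λ i → + p * binomQuot i) ⊛ (λ j → (+ p) ^ m * G j)) t
      ≡⟨ ⊛-scaleˡ (+ p) binomQuot _ t ⟩
    + p * (binomQuot ⊛ (λ j → (+ p) ^ m * G j)) t
      ≡⟨ cong (+ p *_) (⊛-scaleʳ ((+ p) ^ m) binomQuot G t) ⟩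
    + p * ((+ p) ^ m * (binomQuot ⊛ G) t)
      ≡⟨ ℤ.*-assoc (+ p) ((+ p) ^ m) _ ⟨
    (+ p) ^ suc m * (binomQuot ⊛ G) t
      ≡⟨ cong ((+ p) ^ suc m *_) (expand t) ⟩
    (+ p) ^ suc m * (G t + step (binomQuot ∘ suc) G t) ∎
    where
    G = grow (binomQuot ∘ suc) (binom ℓ) m
    below : ∀ {i} → i ≤ t → suc i < p
    below i≤t = ℕ.≤-<-trans (s≤s i≤t) 1+t<p
    expand : ∀ n → (binomQuot ⊛ G) n ≡ G n + step (binomQuot ∘ suc) G n
    expand zero    = trans (cong (_* G 0) binomQuot-0) (trans (ℤ.*-identityˡ (G 0)) (sym (ℤ.+-identityʳ (G 0))))
    expand (suc n) = cong (_+ ((binomQuot ∘ suc) ⊛ G) n)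
      (trans (cong (_* G (suc n)) binomQuot-0) (ℤ.*-identityˡ (G (suc n))))

-- Polynomials over ℚ

-- Rational sums and products are normalised by `_/_`, whereas `fromℤ` builds its fraction directly;
-- this bridges the two.
fromℤ≡/1 : ∀ z → fromℤ z ≡ z ℚ./ 1
fromℤ≡/1 z = sym (ℚ.↥p/↧p≡p (fromℤ z))

fromℤ-+ : ∀ x y → fromℤ (x + y) ≡ fromℤ x ℚ.+ fromℤ y
fromℤ-+ x y = trans (fromℤ≡/1 (x + y))
  (cong₂ (λ a b → (a + b) ℚ./ 1) (sym (ℤ.*-identityʳ x)) (sym (ℤ.*-identityʳ y)))

fromℤ-* : ∀ x y → fromℤ (x * y) ≡ fromℤ x ℚ.* fromℤ y
fromℤ-* x y = fromℤ≡/1 (x * y)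

fromℤ-injective : ∀ {x y} → fromℤ x ≡ fromℤ y → x ≡ y
fromℤ-injective = cong ℚ.numerator

p*q≢0 : ∀ {p q} → p ≢ 0ℚ → q ≢ 0ℚ → p ℚ.* q ≢ 0ℚ
p*q≢0 {p} {q} p≢0 q≢0 pq≡0 = q≢0 (begin
  q                        ≡⟨ ℚ.*-identityˡ q ⟨
  1ℚ ℚ.* q                 ≡⟨ cong (ℚ._* q) (ℚ.*-inverseˡ p) ⟨
  ℚ.1/ p ℚ.* p ℚ.* q       ≡⟨ ℚ.*-assoc (ℚ.1/ p) p q ⟩
  ℚ.1/ p ℚ.* (p ℚ.* q)     ≡⟨ cong (ℚ.1/ p ℚ.*_) pq≡0 ⟩
  ℚ.1/ p ℚ.* 0ℚ            ≡⟨ ℚ.*-zeroʳ (ℚ.1/ p) ⟩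
  0ℚ                       ∎)
  where instance _ = ℚ.≢-nonZero p≢0

infixl 6 _⊕_
infixl 7 _⊙_

_⊕_ : ℚ[x] → ℚ[x] → ℚ[x]
[]      ⊕ Q       = Q
(a ∷ P) ⊕ []      = a ∷ P
(a ∷ P) ⊕ (b ∷ Q) = a ℚ.+ b ∷ P ⊕ Q

_⊙_ : ℚ → ℚ[x] → ℚ[x]
c ⊙ []      = []
c ⊙ (a ∷ P) = c ℚ.* a ∷ c ⊙ P

eval-⊕ : ∀ P Q x → eval (P ⊕ Q) x ≡ eval P x ℚ.+ eval Q x
eval-⊕ []      Q       x = sym (ℚ.+-identityˡ (eval Q x))
eval-⊕ (a ∷ P) []      x = sym (ℚ.+-identityʳ (eval (a ∷ P) x))
eval-⊕ (a ∷ P) (b ∷ Q) x rewrite eval-⊕ P Q x =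
  solve 5 (λ a b x u v → a :+ b :+ x :* (u :+ v) := a :+ x :* u :+ (b :+ x :* v)) refl
    a b x (eval P x) (eval Q x)
  where open +-*-Solver

eval-⊙ : ∀ c P x → eval (c ⊙ P) x ≡ c ℚ.* eval P x
eval-⊙ c []      x = sym (ℚ.*-zeroʳ c)
eval-⊙ c (a ∷ P) x rewrite eval-⊙ c P x =
  solve 4 (λ c a x u → c :* a :+ x :* (c :* u) := c :* (a :+ x :* u)) refl c a x (eval P x)
  where open +-*-Solver

coeff-⊕ : ∀ P Q k → coeff (P ⊕ Q) k ≡ coeff P k ℚ.+ coeff Q k
coeff-⊕ []      Q       k       = sym (ℚ.+-identityˡ (coeff Q k))
coeff-⊕ (a ∷ P) []      k       = sym (ℚ.+-identityʳ (coeff (a ∷ P) k))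
coeff-⊕ (a ∷ P) (b ∷ Q) zero    = refl
coeff-⊕ (a ∷ P) (b ∷ Q) (suc k) = coeff-⊕ P Q k

coeff-⊙ : ∀ c P k → coeff (c ⊙ P) k ≡ c ℚ.* coeff P k
coeff-⊙ c []      k       = sym (ℚ.*-zeroʳ c)
coeff-⊙ c (a ∷ P) zero    = refl
coeff-⊙ c (a ∷ P) (suc k) = coeff-⊙ c P k

HasDegree-⊙ : ∀ {c P d} → c ≢ 0ℚ → HasDegree P d → HasDegree (c ⊙ P) d
HasDegree-⊙ {c} {P} {d} c≢0 (lead , high) =
  (λ eq → p*q≢0 c≢0 lead (trans (sym (coeff-⊙ c P d)) eq)) ,
  (λ k d<k → trans (coeff-⊙ c P k) (trans (cong (c ℚ.*_) (high k d<k)) (ℚ.*-zeroʳ c)))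

HasDegree-⊕ : ∀ {P Q d} → (∀ k → d ≤ k → coeff P k ≡ 0ℚ) → HasDegree Q d → HasDegree (P ⊕ Q) d
HasDegree-⊕ {P} {Q} {d} low (lead , high) =
  (λ eq → lead (trans (sym (sum d ℕ.≤-refl)) eq)) ,
  (λ k d<k → trans (sum k (ℕ.<⇒≤ d<k)) (high k d<k))
  where
  sum : ∀ k → d ≤ k → coeff (P ⊕ Q) k ≡ coeff Q k
  sum k d≤k = trans (coeff-⊕ P Q k) (trans (cong (ℚ._+ coeff Q k) (low k d≤k)) (ℚ.+-identityˡ (coeff Q k)))

-- Binomial polynomials

fromℕ : ℕ → ℚ
fromℕ n = fromℤ (+ n)

linear* : ℚ → ℚ[x] → ℚ[x]
linear* a P = (0ℚ ∷ P) ⊕ (ℚ.- a) ⊙ P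

eval-linear* : ∀ a P x → eval (linear* a P) x ≡ (x ℚ.- a) ℚ.* eval P x
eval-linear* a P x = begin
  eval (linear* a P) x
    ≡⟨ eval-⊕ (0ℚ ∷ P) ((ℚ.- a) ⊙ P) x ⟩
  0ℚ ℚ.+ x ℚ.* eval P x ℚ.+ eval ((ℚ.- a) ⊙ P) x
    ≡⟨ cong₂ ℚ._+_ (ℚ.+-identityˡ (x ℚ.* eval P x)) (eval-⊙ (ℚ.- a) P x) ⟩
  x ℚ.* eval P x ℚ.+ (ℚ.- a) ℚ.* eval P x
    ≡⟨ ℚ.*-distribʳ-+ (eval P x) x (ℚ.- a) ⟨
  (x ℚ.- a) ℚ.* eval P x ∎

-- From degree `suc d` on, the summand -a P contributes nothing and x P is P with its coefficients
-- shifted.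
HasDegree-linear* : ∀ {a P d} → HasDegree P d → HasDegree (linear* a P) (suc d)
HasDegree-linear* {a} {P} {d} (lead , high) =
  (λ eq → lead (trans (sym (shift d ℕ.≤-refl)) eq)) ,
  λ { (suc k) (s<s d<k) → trans (shift k (ℕ.<⇒≤ d<k)) (high k d<k) }
  where
  shift : ∀ k → d ≤ k → coeff (linear* a P) (suc k) ≡ coeff P k
  shift k d≤k = begin
    coeff (linear* a P) (suc k)                    ≡⟨ coeff-⊕ (0ℚ ∷ P) ((ℚ.- a) ⊙ P) (suc k) ⟩
    coeff P k ℚ.+ coeff ((ℚ.- a) ⊙ P) (suc k)      ≡⟨ cong (coeff P k ℚ.+_) (coeff-⊙ (ℚ.- a) P (suc k)) ⟩
    coeff P k ℚ.+ (ℚ.- a) ℚ.* coeff P (suc k)      ≡⟨ cong (λ z → coeff P k ℚ.+ (ℚ.- a) ℚ.* z) (high (suc k) (s≤s d≤k)) ⟩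
    coeff P k ℚ.+ (ℚ.- a) ℚ.* 0ℚ                   ≡⟨ cong (coeff P k ℚ.+_) (ℚ.*-zeroʳ (ℚ.- a)) ⟩
    coeff P k ℚ.+ 0ℚ                               ≡⟨ ℚ.+-identityʳ (coeff P k) ⟩
    coeff P k                                      ∎

-- The polynomial x(x-1)...(x-j+1)/j!, built from C(x,j+1) = (x-j)/(j+1) · C(x,j).
binomPoly : ℕ → ℚ[x]
binomPoly zero    = 1ℚ ∷ []
binomPoly (suc j) = ℚ.1/ fromℕ (suc j) ⊙ linear* (fromℕ j) (binomPoly j)

HasDegree-binomPoly : ∀ j → HasDegree (binomPoly j) j
HasDegree-binomPoly zero    = (λ ()) , λ { (suc k) _ → refl }
HasDegree-binomPoly (suc j) = HasDegree-⊙ {P = linear* (fromℕ j) (binomPoly j)} (λ ())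
  (HasDegree-linear* {P = binomPoly j} (HasDegree-binomPoly j))

eval-binomPoly-0 : ∀ x → eval (binomPoly 0) x ≡ 1ℚ
eval-binomPoly-0 x = cong (1ℚ ℚ.+_) (ℚ.*-zeroʳ x)

[1+j]*binomPoly : ∀ j x → fromℕ (suc j) ℚ.* eval (binomPoly (suc j)) x ≡
                  (x ℚ.- fromℕ j) ℚ.* eval (binomPoly j) x
[1+j]*binomPoly j x = begin
  n ℚ.* eval (binomPoly (suc j)) x  ≡⟨ cong (n ℚ.*_) (eval-⊙ (ℚ.1/ n) (linear* (fromℕ j) (binomPoly j)) x) ⟩
  n ℚ.* (ℚ.1/ n ℚ.* v)              ≡⟨ ℚ.*-assoc n (ℚ.1/ n) v ⟨
  n ℚ.* ℚ.1/ n ℚ.* v                ≡⟨ cong (ℚ._* v) (ℚ.*-inverseʳ n) ⟩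
  1ℚ ℚ.* v                          ≡⟨ ℚ.*-identityˡ v ⟩
  v                                 ≡⟨ eval-linear* (fromℕ j) (binomPoly j) x ⟩
  (x ℚ.- fromℕ j) ℚ.* eval (binomPoly j) x ∎
  where
  n = fromℕ (suc j)
  v = eval (linear* (fromℕ j) (binomPoly j)) x

*-cancelˡ : ∀ n {x y} → fromℕ (suc n) ℚ.* x ≡ fromℕ (suc n) ℚ.* y → x ≡ y
*-cancelˡ n {x} {y} eq = begin
  x                        ≡⟨ undo x ⟨
  ℚ.1/ k ℚ.* (k ℚ.* x)     ≡⟨ cong (ℚ.1/ k ℚ.*_) eq ⟩
  ℚ.1/ k ℚ.* (k ℚ.* y)     ≡⟨ undo y ⟩
  y                        ∎
  where
  k = fromℕ (suc n)
  undo : ∀ z → ℚ.1/ k ℚ.* (k ℚ.* z) ≡ z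
  undo z = trans (sym (ℚ.*-assoc (ℚ.1/ k) k z))
    (trans (cong (ℚ._* z) (ℚ.*-inverseˡ k)) (ℚ.*-identityˡ z))

-- Induction on `j`: clear the denominator, apply the recursion of `binomPoly` and the rule one
-- degree lower, then cancel.
binomPoly-pascal : ∀ j x → eval (binomPoly (suc j)) (1ℚ ℚ.+ x) ≡
                   eval (binomPoly (suc j)) x ℚ.+ eval (binomPoly j) x
binomPoly-pascal zero x = *-cancelˡ 0 (begin
  1ℚ ℚ.* eval (binomPoly 1) (1ℚ ℚ.+ x)
    ≡⟨ [1+j]*binomPoly 0 (1ℚ ℚ.+ x) ⟩
  (1ℚ ℚ.+ x ℚ.- 0ℚ) ℚ.* eval (binomPoly 0) (1ℚ ℚ.+ x)
    ≡⟨ cong ((1ℚ ℚ.+ x ℚ.- 0ℚ) ℚ.*_) (trans (eval-binomPoly-0 (1ℚ ℚ.+ x)) (sym (eval-binomPoly-0 x))) ⟩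
  (1ℚ ℚ.+ x ℚ.- 0ℚ) ℚ.* B
    ≡⟨ solve 2 (λ x b → (con 1ℚ :+ x :- con 0ℚ) :* b := (x :- con 0ℚ) :* b :+ b) refl x B ⟩
  (x ℚ.- 0ℚ) ℚ.* B ℚ.+ B
    ≡⟨ cong (ℚ._+ B) ([1+j]*binomPoly 0 x) ⟨
  1ℚ ℚ.* eval (binomPoly 1) x ℚ.+ B
    ≡⟨ solve 2 (λ a b → con 1ℚ :* a :+ b := con 1ℚ :* (a :+ b)) refl (eval (binomPoly 1) x) B ⟩
  1ℚ ℚ.* (eval (binomPoly 1) x ℚ.+ B) ∎)
  where
  open +-*-Solver
  B = eval (binomPoly 0) x
binomPoly-pascal (suc j) x = *-cancelˡ (suc j) (begin
  fromℕ (2 ℕ.+ j) ℚ.* eval (binomPoly (2 ℕ.+ j)) (1ℚ ℚ.+ x)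
    ≡⟨ [1+j]*binomPoly (suc j) (1ℚ ℚ.+ x) ⟩
  (1ℚ ℚ.+ x ℚ.- fromℕ (suc j)) ℚ.* eval (binomPoly (suc j)) (1ℚ ℚ.+ x)
    ≡⟨ cong₂ (λ u v → (1ℚ ℚ.+ x ℚ.- u) ℚ.* v) (fromℤ-+ 1ℤ (+ j)) (binomPoly-pascal j x) ⟩
  (1ℚ ℚ.+ x ℚ.- (1ℚ ℚ.+ n)) ℚ.* (B₁ ℚ.+ B₀)
    ≡⟨ solve 4 (λ x n b₁ b₀ → (con 1ℚ :+ x :- (con 1ℚ :+ n)) :* (b₁ :+ b₀)
                              := (x :- n) :* b₁ :+ (x :- n) :* b₀) refl x n B₁ B₀ ⟩
  (x ℚ.- n) ℚ.* B₁ ℚ.+ (x ℚ.- n) ℚ.* B₀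
    -- The recursion read backwards turns the `B₀` term into a multiple of `B₁`. The total factor
    -- x+1 is then split as (x-(j+1)) + (j+2).
    ≡⟨ cong ((x ℚ.- n) ℚ.* B₁ ℚ.+_) ([1+j]*binomPoly j x) ⟨
  (x ℚ.- n) ℚ.* B₁ ℚ.+ fromℕ (suc j) ℚ.* B₁
    ≡⟨ cong (λ u → (x ℚ.- n) ℚ.* B₁ ℚ.+ u ℚ.* B₁) (fromℤ-+ 1ℤ (+ j)) ⟩
  (x ℚ.- n) ℚ.* B₁ ℚ.+ (1ℚ ℚ.+ n) ℚ.* B₁
    ≡⟨ solve 3 (λ x n b₁ → (x :- n) :* b₁ :+ (con 1ℚ :+ n) :* b₁
                           := (x :- (con 1ℚ :+ n)) :* b₁ :+ (con 1ℚ :+ (con 1ℚ :+ n)) :* b₁) refl x n B₁ ⟩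
  (x ℚ.- (1ℚ ℚ.+ n)) ℚ.* B₁ ℚ.+ (1ℚ ℚ.+ (1ℚ ℚ.+ n)) ℚ.* B₁
    ≡⟨ cong (λ u → (x ℚ.- u) ℚ.* B₁ ℚ.+ (1ℚ ℚ.+ u) ℚ.* B₁) (fromℤ-+ 1ℤ (+ j)) ⟨
  (x ℚ.- fromℕ (suc j)) ℚ.* B₁ ℚ.+ (1ℚ ℚ.+ fromℕ (suc j)) ℚ.* B₁
    ≡⟨ cong₂ (λ u v → u ℚ.+ v ℚ.* B₁) ([1+j]*binomPoly (suc j) x) (fromℤ-+ 1ℤ (+ suc j)) ⟨
  fromℕ (2 ℕ.+ j) ℚ.* eval (binomPoly (2 ℕ.+ j)) x ℚ.+ fromℕ (2 ℕ.+ j) ℚ.* B₁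
    ≡⟨ ℚ.*-distribˡ-+ (fromℕ (2 ℕ.+ j)) (eval (binomPoly (2 ℕ.+ j)) x) B₁ ⟨
  fromℕ (2 ℕ.+ j) ℚ.* (eval (binomPoly (2 ℕ.+ j)) x ℚ.+ B₁) ∎)
  where
  open +-*-Solver
  n = fromℕ j
  B₀ = eval (binomPoly j) x
  B₁ = eval (binomPoly (suc j)) x

binomPoly-suc-at-0 : ∀ j → eval (binomPoly (suc j)) 0ℚ ≡ 0ℚ
binomPoly-suc-at-0 zero    = refl
binomPoly-suc-at-0 (suc j) = *-cancelˡ (suc j) (begin
  fromℕ (2 ℕ.+ j) ℚ.* eval (binomPoly (2 ℕ.+ j)) 0ℚ           ≡⟨ [1+j]*binomPoly (suc j) 0ℚ ⟩
  (0ℚ ℚ.- fromℕ (suc j)) ℚ.* eval (binomPoly (suc j)) 0ℚ      ≡⟨ cong ((0ℚ ℚ.- fromℕ (suc j)) ℚ.*_) (binomPoly-suc-at-0 j) ⟩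
  (0ℚ ℚ.- fromℕ (suc j)) ℚ.* 0ℚ                               ≡⟨ ℚ.*-zeroʳ (0ℚ ℚ.- fromℕ (suc j)) ⟩
  0ℚ                                                          ≡⟨ ℚ.*-zeroʳ (fromℕ (2 ℕ.+ j)) ⟨
  fromℕ (2 ℕ.+ j) ℚ.* 0ℚ                                      ∎)

-- Newton expansions with integer coefficients

newton : (ℕ → ℤ) → ℕ → ℚ[x]
newton c zero    = fromℤ (c 0) ⊙ binomPoly 0
newton c (suc n) = newton c n ⊕ fromℤ (c (suc n)) ⊙ binomPoly (suc n)

eval-newton-zero : ∀ c x → eval (newton c 0) x ≡ fromℤ (c 0)
eval-newton-zero c x = begin
  eval (fromℤ (c 0) ⊙ binomPoly 0) x       ≡⟨ eval-⊙ (fromℤ (c 0)) (binomPoly 0) x ⟩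
  fromℤ (c 0) ℚ.* eval (binomPoly 0) x     ≡⟨ cong (fromℤ (c 0) ℚ.*_) (eval-binomPoly-0 x) ⟩
  fromℤ (c 0) ℚ.* 1ℚ                       ≡⟨ ℚ.*-identityʳ _ ⟩
  fromℤ (c 0)                              ∎

eval-newton-suc : ∀ c n x → eval (newton c (suc n)) x ≡
                  eval (newton c n) x ℚ.+ fromℤ (c (suc n)) ℚ.* eval (binomPoly (suc n)) x
eval-newton-suc c n x = trans (eval-⊕ (newton c n) _ x)
  (cong (eval (newton c n) x ℚ.+_) (eval-⊙ (fromℤ (c (suc n))) (binomPoly (suc n)) x))

newton-at-0 : ∀ c n → eval (newton c n) 0ℚ ≡ fromℤ (c 0)
newton-at-0 c zero    = eval-newton-zero c 0ℚ
newton-at-0 c (suc n) = begin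
  eval (newton c (suc n)) 0ℚ
    ≡⟨ eval-newton-suc c n 0ℚ ⟩
  eval (newton c n) 0ℚ ℚ.+ fromℤ (c (suc n)) ℚ.* eval (binomPoly (suc n)) 0ℚ
    ≡⟨ cong₂ (λ u v → u ℚ.+ fromℤ (c (suc n)) ℚ.* v) (newton-at-0 c n) (binomPoly-suc-at-0 n) ⟩
  fromℤ (c 0) ℚ.+ fromℤ (c (suc n)) ℚ.* 0ℚ
    ≡⟨ solve 2 (λ a b → a :+ b :* con 0ℚ := a) refl (fromℤ (c 0)) (fromℤ (c (suc n))) ⟩
  fromℤ (c 0) ∎
  where open +-*-Solver

-- Since C(x+1,j) - C(x,j) = C(x,j-1), differencing a Newton expansion shifts its coefficients and
-- lowers its degree bound by one.
newton-pascal : ∀ c n x → eval (newton c (suc n)) (1ℚ ℚ.+ x) ≡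
                eval (newton c (suc n)) x ℚ.+ eval (newton (c ∘ suc) n) x
newton-pascal c n x = begin
  eval (newton c (suc n)) (1ℚ ℚ.+ x)
    ≡⟨ eval-newton-suc c n (1ℚ ℚ.+ x) ⟩
  eval (newton c n) (1ℚ ℚ.+ x) ℚ.+ k n ℚ.* eval (binomPoly (suc n)) (1ℚ ℚ.+ x)
    ≡⟨ cong (λ u → eval (newton c n) (1ℚ ℚ.+ x) ℚ.+ k n ℚ.* u) (binomPoly-pascal n x) ⟩
  eval (newton c n) (1ℚ ℚ.+ x) ℚ.+ k n ℚ.* (B (suc n) ℚ.+ B n)
    ≡⟨ regroup n ⟩
  eval (newton c n) x ℚ.+ k n ℚ.* B (suc n) ℚ.+ eval (newton (c ∘ suc) n) x
    ≡⟨ cong (ℚ._+ eval (newton (c ∘ suc) n) x) (eval-newton-suc c n x) ⟨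
  eval (newton c (suc n)) x ℚ.+ eval (newton (c ∘ suc) n) x ∎
  where
  open +-*-Solver
  k B : ℕ → ℚ
  k n = fromℤ (c (suc n))
  B n = eval (binomPoly n) x
  -- The lower partial sum at 1+x is constant for `n` = 0; otherwise `newton-pascal` one degree
  -- lower expands it.
  regroup : ∀ n → eval (newton c n) (1ℚ ℚ.+ x) ℚ.+ k n ℚ.* (B (suc n) ℚ.+ B n) ≡
                  eval (newton c n) x ℚ.+ k n ℚ.* B (suc n) ℚ.+ eval (newton (c ∘ suc) n) x
  regroup zero = begin
    eval (newton c 0) (1ℚ ℚ.+ x) ℚ.+ k 0 ℚ.* (B 1 ℚ.+ B 0)
      ≡⟨ cong₂ (λ u v → u ℚ.+ k 0 ℚ.* (B 1 ℚ.+ v))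
           (trans (eval-newton-zero c (1ℚ ℚ.+ x)) (sym (eval-newton-zero c x))) (eval-binomPoly-0 x) ⟩
    N ℚ.+ k 0 ℚ.* (B 1 ℚ.+ 1ℚ)
      ≡⟨ solve 3 (λ a k b → a :+ k :* (b :+ con 1ℚ) := a :+ k :* b :+ k) refl N (k 0) (B 1) ⟩
    N ℚ.+ k 0 ℚ.* B 1 ℚ.+ k 0
      ≡⟨ cong (N ℚ.+ k 0 ℚ.* B 1 ℚ.+_) (eval-newton-zero (c ∘ suc) x) ⟨
    N ℚ.+ k 0 ℚ.* B 1 ℚ.+ eval (newton (c ∘ suc) 0) x ∎
    where N = eval (newton c 0) x
  regroup (suc n) = begin
    eval (newton c (suc n)) (1ℚ ℚ.+ x) ℚ.+ k₁ ℚ.* (B₂ ℚ.+ B₁)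
      ≡⟨ cong (ℚ._+ k₁ ℚ.* (B₂ ℚ.+ B₁)) (newton-pascal c n x) ⟩
    N ℚ.+ M ℚ.+ k₁ ℚ.* (B₂ ℚ.+ B₁)
      ≡⟨ solve 5 (λ a m k b₂ b₁ → a :+ m :+ k :* (b₂ :+ b₁) := a :+ k :* b₂ :+ (m :+ k :* b₁)) refl
           N M k₁ B₂ B₁ ⟩
    N ℚ.+ k₁ ℚ.* B₂ ℚ.+ (M ℚ.+ k₁ ℚ.* B₁)
      ≡⟨ cong (N ℚ.+ k₁ ℚ.* B₂ ℚ.+_) (eval-newton-suc (c ∘ suc) n x) ⟨
    N ℚ.+ k₁ ℚ.* B₂ ℚ.+ eval (newton (c ∘ suc) (suc n)) x ∎
    where
    N  = eval (newton c (suc n)) x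
    M  = eval (newton (c ∘ suc) n) x
    k₁ = k (suc n)
    B₁ = B (suc n)
    B₂ = B (suc (suc n))

-- By induction on `n` the difference is integer-valued, so integrality passes between z and z+1
-- both ways, starting from the value `c 0` at 0.
newton-integerValued : ∀ c n → IntegerValued (newton c n)
newton-integerValued c zero    z = c 0 , eval-newton-zero c (fromℤ z)
newton-integerValued c (suc n) = valued
  where
  N M : ℤ → ℚ
  N z = eval (newton c (suc n)) (fromℤ z)
  M z = eval (newton (c ∘ suc) n) (fromℤ z)
  difference : ∀ z → N (1ℤ + z) ≡ N z ℚ.+ M z
  difference z = trans (cong (eval (newton c (suc n))) (fromℤ-+ 1ℤ z)) (newton-pascal c n (fromℤ z))
  up : ∀ z → (∃ λ w → N z ≡ fromℤ w) → ∃ λ w → N (1ℤ + z) ≡ fromℤ w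
  up z (v , Nz≡v) with w , Mz≡w ← newton-integerValued (c ∘ suc) n z =
    v + w , trans (difference z) (trans (cong₂ ℚ._+_ Nz≡v Mz≡w) (sym (fromℤ-+ v w)))
  down : ∀ z → (∃ λ w → N (1ℤ + z) ≡ fromℤ w) → ∃ λ w → N z ≡ fromℤ w
  down z (v , N1+z≡v) with w , Mz≡w ← newton-integerValued (c ∘ suc) n z =
    v - w , (begin
      -- Subtraction is a product with `fromℤ -1ℤ`, so that `fromℤ-*` and `fromℤ-+` carry it back to
      -- ℤ.
      N z                        ≡⟨ solve 2 (λ a b → a := a :+ b :+ con (fromℤ -1ℤ) :* b) refl (N z) (M z) ⟩
      N z ℚ.+ M z ℚ.+ fromℤ -1ℤ ℚ.* M z
                                 ≡⟨ cong₂ (λ a b → a ℚ.+ fromℤ -1ℤ ℚ.* b) (trans (sym (difference z)) N1+z≡v) Mz≡w ⟩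
      fromℤ v ℚ.+ fromℤ -1ℤ ℚ.* fromℤ w
                                 ≡⟨ cong (fromℤ v ℚ.+_) (fromℤ-* -1ℤ w) ⟨
      fromℤ v ℚ.+ fromℤ (-1ℤ * w) ≡⟨ fromℤ-+ v (-1ℤ * w) ⟨
      fromℤ (v + -1ℤ * w)        ≡⟨ cong (λ u → fromℤ (v + u)) (ℤ.-1*i≡-i w) ⟩
      fromℤ (v - w)              ∎)
    where open +-*-Solver
  valued : IntegerValued (newton c (suc n))
  valued (+ zero)       = c 0 , newton-at-0 c (suc n)
  valued (+ suc k)      = up (+ k) (valued (+ k))
  valued -[1+ zero ]    = down -1ℤ (valued (+ 0))
  valued -[1+ suc k ]   = down -[1+ suc k ] (valued -[1+ k ])

-- Only the last term reaches degree `n`; all earlier ones stay below.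
HasDegree-newton : ∀ c n → c n ≢ 0ℤ → HasDegree (newton c n) n
HasDegree-newton c zero    c≢0 =
  HasDegree-⊙ {P = binomPoly 0} (c≢0 ∘ fromℤ-injective) (HasDegree-binomPoly 0)
HasDegree-newton c (suc n) c≢0 =
  HasDegree-⊕ {P = newton c n} (low n)
    (HasDegree-⊙ {P = binomPoly (suc n)} (c≢0 ∘ fromℤ-injective) (HasDegree-binomPoly (suc n)))
  where
  term : ∀ j k → j < k → coeff (fromℤ (c j) ⊙ binomPoly j) k ≡ 0ℚ
  term j k j<k = trans (coeff-⊙ (fromℤ (c j)) (binomPoly j) k)
    (trans (cong (fromℤ (c j) ℚ.*_) (proj₂ (HasDegree-binomPoly j) k j<k)) (ℚ.*-zeroʳ (fromℤ (c j))))
  low : ∀ n k → n < k → coeff (newton c n) k ≡ 0ℚ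
  low zero    k 0<k = term 0 k 0<k
  low (suc n) k n<k = trans (coeff-⊕ (newton c n) _ k)
    (trans (cong₂ ℚ._+_ (low n k (ℕ.<-trans (ℕ.n<1+n n) n<k)) (term (suc n) k n<k)) (ℚ.+-identityˡ 0ℚ))

-- The binomial theorem (1 + y w)^m g = Σ_j C(m,j) (y w)^j g at y^t, where (y w)^j vanishes for j >
-- t. In the induction on `m`, `newton-pascal` matches the recursion of `grow`.
newton-grow : ∀ w g m t →
  eval (newton (λ j → stepPow w g j t) t) (fromℕ m) ≡ fromℤ (grow w g m t)
newton-grow w g zero    t    = newton-at-0 (λ j → stepPow w g j t) t
newton-grow w g (suc m) zero = begin
  eval (newton c 0) (fromℕ (suc m))  ≡⟨ eval-newton-zero c (fromℕ (suc m)) ⟩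
  fromℤ (g 0)                        ≡⟨ eval-newton-zero c (fromℕ m) ⟨
  eval (newton c 0) (fromℕ m)        ≡⟨ newton-grow w g m 0 ⟩
  fromℤ (grow w g m 0)               ≡⟨ cong fromℤ (ℤ.+-identityʳ (grow w g m 0)) ⟨
  fromℤ (grow w g m 0 + 0ℤ)          ∎
  where
  c : ℕ → ℤ
  c j = stepPow w g j 0
newton-grow w g (suc m) (suc t) = begin
  eval (newton c (suc t)) (fromℕ (suc m))
    ≡⟨ cong (eval (newton c (suc t))) (fromℤ-+ 1ℤ (+ m)) ⟩
  eval (newton c (suc t)) (1ℚ ℚ.+ fromℕ m)
    ≡⟨ newton-pascal c t (fromℕ m) ⟩
  eval (newton c (suc t)) (fromℕ m) ℚ.+ eval (newton (c ∘ suc) t) (fromℕ m)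
    ≡⟨ cong₂ ℚ._+_ (newton-grow w g m (suc t)) shifted ⟩
  fromℤ (grow w g m (suc t)) ℚ.+ fromℤ (step w (grow w g m) (suc t))
    ≡⟨ fromℤ-+ (grow w g m (suc t)) (step w (grow w g m) (suc t)) ⟨
  fromℤ (grow w g (suc m) (suc t)) ∎
  where
  c : ℕ → ℤ
  c j = stepPow w g j (suc t)
  -- The order of (y w)^(t+2) g exceeds t+1, so a zero term can lengthen the shifted expansion to
  -- the length that the induction hypothesis expects.
  c≡0 : c (suc (suc t)) ≡ 0ℤ
  c≡0 = stepPow-vanish w (suc (suc t)) (λ _ ()) (suc t) (ℕ.m≤m+n (suc (suc t)) 0)
  M = eval (newton (c ∘ suc) t) (fromℕ m)
  B = eval (binomPoly (suc t)) (fromℕ m)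
  shifted : M ≡ fromℤ (step w (grow w g m) (suc t))
  shifted = begin
    M                                              ≡⟨ solve 2 (λ a b → a := a :+ con 0ℚ :* b) refl M B ⟩
    M ℚ.+ 0ℚ ℚ.* B                                 ≡⟨ cong (λ u → M ℚ.+ fromℤ u ℚ.* B) c≡0 ⟨
    M ℚ.+ fromℤ (c (suc (suc t))) ℚ.* B            ≡⟨ eval-newton-suc (c ∘ suc) t (fromℕ m) ⟨
    -- By definition of `stepPow`, `c ∘ suc` is the coefficient sequence belonging to `step w g`.
    eval (newton (c ∘ suc) (suc t)) (fromℕ m)      ≡⟨ newton-grow w (step w g) m (suc t) ⟩
    fromℤ (grow w (step w g) m (suc t))            ≡⟨ cong fromℤ (step-grow w g m (suc t)) ⟨
    fromℤ (step w (grow w g m) (suc t))            ∎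
    where open +-*-Solver

theorem6p1 : ∀ (p ℓ s : ℕ) → Prime p → 0 < s → s < p →
    (∀ (m : ℕ) → (+ p) ℤ.^ m ∣ altSum p ℓ s m)
    × (∃ λ (Q : ℚ[x]) →
    HasDegree Q (s ∸ 1)
    × IntegerValued Q
    × (∀ (m : ℕ) → fromℤ (altSum p ℓ s m) ≡ fromℤ ((+ p) ℤ.^ m) ℚ.* eval Q (fromℤ (+ m))))
theorem6p1 p ℓ (suc t) pr _ 1+t<p =
    -- Integer divisibility is divisibility of absolute values, hence the quotient `∣ G m ∣`.
    (λ m → ℕ.divides ℤ.∣ G m ∣ (begin
      ℤ.∣ altSum p ℓ (suc t) m ∣            ≡⟨ cong ℤ.∣_∣ (factor m) ⟩
      ℤ.∣ (+ p) ^ m * G m ∣                 ≡⟨ ℤ.abs-* ((+ p) ^ m) (G m) ⟩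
      ℤ.∣ (+ p) ^ m ∣ ℕ.* ℤ.∣ G m ∣         ≡⟨ ℕ.*-comm ℤ.∣ (+ p) ^ m ∣ ℤ.∣ G m ∣ ⟩
      ℤ.∣ G m ∣ ℕ.* ℤ.∣ (+ p) ^ m ∣         ∎))
  , newton c t
  , HasDegree-newton c t (lead≢0 t 1+t<p)
  , newton-integerValued c t
  , (λ m → begin
      fromℤ (altSum p ℓ (suc t) m)                  ≡⟨ cong fromℤ (factor m) ⟩
      fromℤ ((+ p) ^ m * G m)                       ≡⟨ fromℤ-* ((+ p) ^ m) (G m) ⟩
      fromℤ ((+ p) ^ m) ℚ.* fromℤ (G m)             ≡⟨ cong (fromℤ ((+ p) ^ m) ℚ.*_) (newton-grow w (binom ℓ) m t) ⟨
      fromℤ ((+ p) ^ m) ℚ.* eval (newton c t) (fromℤ (+ m)) ∎)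
  where
  w : ℕ → ℤ
  w = binomQuot pr ∘ suc
  G c : ℕ → ℤ
  G m = grow w (binom ℓ) m t
  c j = stepPow w (binom ℓ) j t
  factor : ∀ m → altSum p ℓ (suc t) m ≡ (+ p) ^ m * G m
  factor m = begin
    altSum p ℓ (suc t) m             ≡⟨ altSum≡diff p ℓ (suc t) m ⟩
    progDiff p ℓ m (m ℕ.+ suc t ∸ 1) ≡⟨ cong (λ k → progDiff p ℓ m (k ∸ 1)) (ℕ.+-suc m t) ⟩
    progDiff p ℓ m (m ℕ.+ t)         ≡⟨ progDiff-factor pr ℓ m t 1+t<p ⟩
    (+ p) ^ m * G m                  ∎
  lead≡ : ∀ t → stepPow w (binom ℓ) t t ≡ w 0 ^ t
  lead≡ t = begin
    stepPow w (binom ℓ) t t            ≡⟨ cong (stepPow w (binom ℓ) t) (ℕ.+-identityʳ t) ⟨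
    stepPow w (binom ℓ) t (t ℕ.+ 0)    ≡⟨ stepPow-lead w t (λ _ ()) ⟩
    w 0 ^ t * 1ℤ                       ≡⟨ ℤ.*-identityʳ (w 0 ^ t) ⟩
    w 0 ^ t                            ∎
  -- For `t` = 0 the coefficient is C(ℓ,0) = 1; otherwise p > 2, so w(0) = C(p,2)/p is nonzero and
  -- so are its powers.
  lead≢0 : ∀ t → suc t < p → stepPow w (binom ℓ) t t ≢ 0ℤ
  lead≢0 zero    _     ()
  lead≢0 (suc t) 2+t<p eq = binomQuot≢0 pr (ℕ.≤-<-trans (s≤s (s≤s z≤n)) 2+t<p)
    (ℤ.i^n≡0⇒i≡0 (w 0) (suc t) (trans (sym (lead≡ (suc t))) eq))
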